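{- Let $\mathcal{A}=\{A_1,\dots,A_m\}$ be a bimodal collection of pairwise disjoint nonempty subsets of a finite abelian group $G$, with internal difference groups $H_1,\dots,H_m$, labelled so that $|A_i|<|H_i|$ exactly for $i=1,\dots,r$, where $r\ge2$. Let $D=(a_1+H_1)\setminus A_1$, where $a_1+H_1$ is the coset of $H_1$ containing $A_1$, and suppose $\mathcal{A}$ is in canonical position, i.e. $D$ is a subgroup of $G$. Let $A=A_1\cup\dots\cup A_m$ and $H=H_1+\dots+H_r$. Then: (1) $H_1,\dots,H_r$ form an $r$-star with kernel $D$ (i.e. $H_i\cap H_j=D$ for all distinct $i,j\le r$), and $A_i=H_i\setminus D$ for each $1\le i\le r$; (2) every $A_i$ with $i>r$ is a coset of a subgroup of $D$; (3) $H\setminus D\subseteq A$, and the sets in $\mathcal{A}$ with index greater than $r$ can be relabelled so that for some $k$ with $r\le k\le m$ the set $H\setminus D$ is partitioned by $A_1,\dots,A_k$; (4) if $k<m$, then the sets $A_i$ with $i>k$ arise from a subdivision of cosets of $H$, i.e. their union is a union of cosets of $H$ and each of them is a coset of a subgroup of $G$ contained in a single coset of $H$.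
   Context: $G$ is written additively. The internal difference group $H_i$ of $A_i$ is the subgroup generated by all $x-y$ with $x,y\in A_i$; $A_i$ lies in a single coset of $H_i$ and $|A_i|\le|H_i|$. A collection $\{A_1,\dots,A_m\}$ of pairwise disjoint subsets of $G$ is bimodal if for every $i$ and every $\delta\in G\setminus\{0\}$, the number $N_i(\delta)$ of pairs $(a,b)$ with $a\in A_i$, $b\in A_j$ for some $j\neq i$, and $a-b=\delta$, satisfies $N_i(\delta)\in\{0,|A_i|\}$. (For such collections with $r\ge2$ the set $D$ equals $(a_i+H_i)\setminus A_i$ for every $i\le r$ and is a coset of a subgroup; canonical position means the collection has been translated so that $D$ is a subgroup.) -}

module Defs where

open import Level using (Level; suc; _⊔_; 0ℓ)
open import Algebra.Bundles using (AbelianGroup)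
import Algebra.Properties.CommutativeMonoid.Sum as Sum
open import Data.Fin.Base using (Fin)
import Data.Fin.Properties as Fin
open import Data.Fin.Subset using (Subset; ∣_∣)
import Data.Fin.Subset as Sub
import Data.Fin.Subset.Properties as Sub
open import Data.List.Base using (List; length; filter; cartesianProduct; allFin; map)
open import Data.Nat.Base using (ℕ)
open import Data.Product.Base using (∃; _×_; _,_; proj₁; proj₂)
open import Data.Sum.Base using (_⊎_)
open import Data.Vec.Base using (tabulate)
open import Data.Vec.Functional using (Vector)
open import Function.Base using (_∘_)
open import Function.Bundles using (Inverse)
open import Relation.Binary.Definitions using (_Respects_; DecidableEquality)
open import Relation.Binary.PropositionalEquality as ≡ using (_≡_; _≢_)
open import Relation.Nullary using (¬_; Dec; does)
open import Relation.Nullary.Decidable using (map′; ¬?; _×-dec_; _→-dec_; decidable-stable)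
open import Relation.Unary using (Pred; Decidable; _∈_; _∩_; _⊆_; _≐_; _⊥_; Satisfiable; ⋃)

record FiniteAbelianGroup (c ℓ : Level) : Set (suc (c ⊔ ℓ)) where
  field
    group       : AbelianGroup c ℓ
    size        : ℕ
    enumeration : Inverse (AbelianGroup.setoid group) (≡.setoid (Fin size))

module Subsets {c ℓ : Level} (G : FiniteAbelianGroup c ℓ) where

  open FiniteAbelianGroup G public
  open AbelianGroup group public
    using (Carrier; _≈_; _≉_; _-_; setoid)
    renaming (_∙_ to _+_; ε to 0#; _⁻¹ to -_)
  open AbelianGroup group using (refl; sym; trans; commutativeMonoid; ∙-cong; ⁻¹-cong)
  open Inverse enumeration using (to; from; to-cong; inverseʳ; strictlyInverseʳ)
  open Sum commutativeMonoid using (sum)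

  private variable
    p q : Level

  -- A subset of the group is coded by the set of positions of its elements in
  -- the enumeration, so that its cardinality is the library's ∣_∣.
  ⟦_⟧ : Subset size → Pred Carrier 0ℓ
  ⟦ A ⟧ x = to x Sub.∈ A

  ⟦⟧-resp : ∀ A → ⟦ A ⟧ Respects _≈_
  ⟦⟧-resp A x≈y = ≡.subst (Sub._∈ A) (to-cong x≈y)

  ⟦_⟧? : ∀ A → Decidable ⟦ A ⟧
  ⟦ A ⟧? x = to x Sub.∈? A

  _≈?_ : ∀ x y → Dec (x ≈ y)
  x ≈? y = map′
    (λ eq → trans (sym (strictlyInverseʳ x)) (inverseʳ eq))
    to-cong (to x Fin.≟ to y)

  all? : {P : Pred Carrier p} → P Respects _≈_ → Decidable P → Dec (∀ x → P x)
  all? resp P? = map′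
    (λ f x → resp (strictlyInverseʳ x) (f (to x)))
    (λ f i → f (from i)) (Fin.all? (P? ∘ from))

  allSubsets? : {P : Pred (Subset size) p} → Decidable P → Dec (∀ K → P K)
  allSubsets? P? = map′
    (λ ¬∃ K → decidable-stable (P? K) (λ ¬PK → ¬∃ (K , ¬PK)))
    (λ f (K , ¬PK) → ¬PK (f K))
    (¬? (Sub.anySubset? (¬? ∘ P?)))

  record IsSubgroup (K : Pred Carrier p) : Set (c ⊔ ℓ ⊔ p) where
    field
      resp       : K Respects _≈_
      0∈         : 0# ∈ K
      +-closed   : ∀ x y → x ∈ K → y ∈ K → (x + y) ∈ K
      neg-closed : ∀ x → x ∈ K → (- x) ∈ K

  isSubgroup? : ∀ K → Dec (IsSubgroup ⟦ K ⟧)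
  isSubgroup? K = map′
    (λ (z , a , n) → record
      { resp = ⟦⟧-resp K ; 0∈ = z ; +-closed = a ; neg-closed = n })
    (λ s → let open IsSubgroup s in 0∈ , +-closed , neg-closed)
    (⟦ K ⟧? 0# ×-dec
     all? (λ eq f y x∈ y∈ → ⟦⟧-resp K (∙-cong eq refl) (f y (⟦⟧-resp K (sym eq) x∈) y∈))
       (λ x → all? (λ eq f x∈ y∈ → ⟦⟧-resp K (∙-cong refl eq) (f x∈ (⟦⟧-resp K (sym eq) y∈)))
         (λ y → ⟦ K ⟧? x →-dec ⟦ K ⟧? y →-dec ⟦ K ⟧? (x + y))) ×-dec
     all? (λ eq f x∈ → ⟦⟧-resp K (⁻¹-cong eq) (f (⟦⟧-resp K (sym eq) x∈)))
       (λ x → ⟦ K ⟧? x →-dec ⟦ K ⟧? (- x)))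

  ContainsDifferences : Subset size → Subset size → Set c
  ContainsDifferences A K = ∀ x y → x ∈ ⟦ A ⟧ → y ∈ ⟦ A ⟧ → (x - y) ∈ ⟦ K ⟧

  containsDifferences? : ∀ A K → Dec (ContainsDifferences A K)
  containsDifferences? A K =
    all? (λ eq f y x∈ y∈ → ⟦⟧-resp K (∙-cong eq refl) (f y (⟦⟧-resp A (sym eq) x∈) y∈))
      (λ x → all? (λ eq f x∈ y∈ → ⟦⟧-resp K (∙-cong refl (⁻¹-cong eq))
                                    (f x∈ (⟦⟧-resp A (sym eq) y∈)))
        (λ y → ⟦ A ⟧? x →-dec ⟦ A ⟧? y →-dec ⟦ K ⟧? (x - y)))

  -- The subgroup generated by the differences of A, as the intersection of all
  -- subgroups that contain them.
  InDifferenceGroup : Subset size → Pred Carrier (c ⊔ ℓ)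
  InDifferenceGroup A x =
    ∀ K → IsSubgroup ⟦ K ⟧ → ContainsDifferences A K → x ∈ ⟦ K ⟧

  inDifferenceGroup? : ∀ A → Decidable (InDifferenceGroup A)
  inDifferenceGroup? A x = allSubsets? λ K →
    isSubgroup? K →-dec containsDifferences? A K →-dec ⟦ K ⟧? x

  differenceGroup : Subset size → Subset size
  differenceGroup A = tabulate (λ i → does (inDifferenceGroup? A (from i)))

  infixr 7 _⊕_
  _⊕_ : Carrier → Pred Carrier p → Pred Carrier (c ⊔ ℓ ⊔ p)
  (g ⊕ K) x = ∃ λ h → h ∈ K × x ≈ g + h

  IsCosetOf : Pred Carrier p → Pred Carrier q → Set _
  IsCosetOf K C = ∃ λ g → C ≐ g ⊕ K

  -- T is a set of representatives, possibly empty or with repetitions.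
  IsUnionOfCosetsOf : Pred Carrier p → Pred Carrier q → Set _
  IsUnionOfCosetsOf K U =
    ∃ λ (T : Subset size) → U ≐ λ x → ∃ λ t → t ∈ ⟦ T ⟧ × x ∈ t ⊕ K

  SumOf : ∀ {r} → (Fin r → Pred Carrier p) → Pred Carrier (c ⊔ ℓ ⊔ p)
  SumOf {r = r} K x = ∃ λ (h : Vector Carrier r) → (∀ i → h i ∈ K i) × x ≈ sum h

  PairwiseDisjoint : ∀ {m} → (Fin m → Pred Carrier p) → Set _
  PairwiseDisjoint A = ∀ i j → i ≢ j → A i ⊥ A j

  IsPartitionOf : ∀ {m} → Pred Carrier q → (Fin m → Pred Carrier p) → Set _
  IsPartitionOf {m = m} U A =
    (∀ i → Satisfiable (A i)) × PairwiseDisjoint A × U ≐ ⋃ (Fin m) A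

  IsStar : ∀ {r} → (Fin r → Pred Carrier p) → Pred Carrier q → Set _
  IsStar K D = ∀ i j → i ≢ j → (K i ∩ K j) ≐ D

  module _ {m : ℕ} (A : Fin m → Subset size) where

    ExternalPair : Fin m → Carrier → Pred (Carrier × Carrier) ℓ
    ExternalPair i δ (a , b) =
      a ∈ ⟦ A i ⟧ × (∃ λ j → j ≢ i × b ∈ ⟦ A j ⟧) × a - b ≈ δ

    externalPair? : ∀ i δ → Decidable (ExternalPair i δ)
    externalPair? i δ (a , b) =
      ⟦ A i ⟧? a ×-dec
      Fin.any? (λ j → ¬? (j Fin.≟ i) ×-dec ⟦ A j ⟧? b) ×-dec
      (a - b) ≈? δ

    elements : List Carrier
    elements = map from (allFin size)

    N : Fin m → Carrier → ℕ
    N i δ = length (filter (externalPair? i δ) (cartesianProduct elements elements))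

    IsBimodal : Set _
    IsBimodal = ∀ i δ → δ ≉ 0# → N i δ ≡ 0 ⊎ N i δ ≡ ∣ A i ∣

{-# OPTIONS --safe #-}
-- Let Bᵢ be the union of the Aⱼ with j ≠ i.  Bimodality says that each translate
-- of Aᵢ is contained in or disjoint from Bᵢ, so that Bᵢ is stable under the
-- differences of Aᵢ, i.e. is a union of Hᵢ-cosets.  Hence the hole
-- (aᵢ + Hᵢ) ∖ Aᵢ misses A, and A together with the hole is a union of Hᵢ-cosets.
-- Comparing two indices shows that all nonempty holes coincide with D.  Then
-- A ∪ D is stable under H₁, …, Hᵣ, hence under H, which gives H ⊆ A ∪ D; and for
-- i > r the set A is Hᵢ-stable, so h ∈ Hᵢ gives a₁ + h ∈ A and thus h ∈ A ∪ D, where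
-- h ∈ A is impossible because then 0 ∈ A ∩ D.
module Submission where

open import Defs
open import Level using (Level)
open import Data.Fin.Base using (Fin; toℕ; inject≤)
open import Data.Fin.Permutation using (Permutation′; _⟨$⟩ʳ_)
open import Data.Fin.Subset using (Subset; ∣_∣)
open import Data.Nat.Base using (ℕ; _≤_; _<_)
open import Data.Product.Base using (∃; _×_)
open import Function.Bundles using (_⇔_)
open import Relation.Binary.PropositionalEquality using (_≡_)
open import Relation.Unary using (_∈_; _⊆_; _≐_; _∖_; Satisfiable; ⋃)

open import Algebra.Bundles using (AbelianGroup)
import Algebra.Properties.AbelianGroup as AbelianGroupProperties
import Algebra.Properties.CommutativeMonoid.Sum as Summation
open import Data.Fin.Base using (zero; suc; fromℕ; fromℕ<; inject₁; punchIn)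
import Data.Fin.Permutation as Perm
import Data.Fin.Properties as Fin
open import Data.Fin.Relation.Unary.Top using (view; ‵fromℕ; ‵inject₁)
import Data.Fin.Subset as Sub
import Data.Fin.Subset.Properties as Sub
open import Data.List.Base using (List; []; _∷_; length; filter; cartesianProduct)
import Data.List.Membership.Propositional as List
import Data.List.Membership.Propositional.Properties as List
open import Data.List.Relation.Unary.All as All using (All; []; _∷_)
open import Data.List.Relation.Unary.AllPairs using (AllPairs; []; _∷_)
import Data.List.Relation.Unary.Unique.Propositional.Properties as Unique
open import Data.Nat.Base using (pred; z≤n; s≤s; z<s)
import Data.Nat.Properties as ℕ
open import Data.Product.Base using (_,_; proj₁; proj₂)
open import Data.Sum.Base as Sum using (inj₁; inj₂)
open import Data.Vec.Base using ([]; _∷_; here; there; tabulate)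
open import Data.Vec.Functional using () renaming (_∷_ to _∷ᶠ_)
import Data.Vec.Properties as Vec
open import Function.Base using (_∘_; _on_)
open import Function.Bundles using (Equivalence; Injection; Inverse)
open import Function.Properties.Inverse using (↔⇒↣)
open import Relation.Binary.Core using (Rel)
open import Relation.Binary.Definitions using (_Respects_)
open import Relation.Binary.PropositionalEquality as ≡ using (_≢_; subst)
open import Relation.Nullary using (Dec; yes; no; ¬_; does; contradiction)
open import Relation.Nullary.Decidable
  using (map′; ¬?; _×-dec_; _→-dec_; decidable-stable; dec-true)
open import Relation.Unary using (Pred; Decidable; _∪_; _∉_)

private variable
  a p q s : Level
  m n : ℕ

-- Finite sets

-- Induction on `S`: each member of `S` uses up its image in `T`, and injectivity keeps the images
-- of the remaining members in what is left.
∣∣-mono-injection : (f : Fin m → Fin n) → (∀ {i j} → f i ≡ f j → i ≡ j) →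
  (S : Subset m) (T : Subset n) → (∀ {i} → i Sub.∈ S → f i Sub.∈ T) → ∣ S ∣ ≤ ∣ T ∣
∣∣-mono-injection f inj [] T f∈ = z≤n
∣∣-mono-injection f inj (Sub.outside ∷ S) T f∈ =
  ∣∣-mono-injection (f ∘ suc) (Fin.suc-injective ∘ inj) S T (f∈ ∘ there)
∣∣-mono-injection f inj (Sub.inside ∷ S) T f∈ = ℕ.≤-trans
  (s≤s (∣∣-mono-injection (f ∘ suc) (Fin.suc-injective ∘ inj) S (T Sub.- f zero)
    λ i∈S → Sub.x∈p∧x≢y⇒x∈p-y (f∈ (there i∈S)) λ eq → Fin.0≢1+n (≡.sym (inj eq))))
  (Sub.x∈p⇒∣p-x∣<∣p∣ (f∈ here))

-- The map `f` allows a list of pairs to be counted by first coordinates.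
length≤∣∣ : {X : Set a} {f : X → Fin n} {xs : List X} (T : Subset n) →
  AllPairs (_≢_ on f) xs → All (λ x → f x Sub.∈ T) xs → length xs ≤ ∣ T ∣
length≤∣∣ T [] [] = z≤n
length≤∣∣ T (x≢ ∷ distinct) (fx∈T ∷ fxs∈T) = ℕ.≤-trans
  (s≤s (length≤∣∣ _ distinct
    (All.zipWith (λ (fy∈T , fx≢fy) → Sub.x∈p∧x≢y⇒x∈p-y fy∈T (fx≢fy ∘ ≡.sym)) (fxs∈T , x≢))))
  (Sub.x∈p⇒∣p-x∣<∣p∣ fx∈T)

-- A property shared by all entries may be used to change the relation: `pairs-distinct` passes in
-- this way from distinct pairs to distinct first coordinates.
AllPairs-refine : {X : Set a} {P : Pred X p} {R : Rel X q} {S : Rel X s} {xs : List X} →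
  (∀ {x y} → P x → P y → R x y → S x y) → All P xs → AllPairs R xs → AllPairs S xs
AllPairs-refine f [] [] = []
AllPairs-refine f (px ∷ pxs) (rx ∷ rxs) =
  All.zipWith (λ (py , r) → f px py r) (pxs , rx) ∷ AllPairs-refine f pxs rxs

inject≤-fromℕ< : {i : Fin n} (i<m : toℕ i < m) (m≤n : m ≤ n) → inject≤ (fromℕ< i<m) m≤n ≡ i
inject≤-fromℕ< i<m m≤n = Fin.toℕ-injective
  (≡.trans (Fin.toℕ-inject≤ (fromℕ< i<m) m≤n) (Fin.toℕ-fromℕ< i<m))

-- Permutations

punchIn-fromℕ : (i : Fin n) → punchIn (fromℕ n) i ≡ inject₁ i
punchIn-fromℕ zero    = ≡.refl
punchIn-fromℕ (suc i) = ≡.cong suc (punchIn-fromℕ i)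

insert-self : ∀ i j (π : Perm.Permutation m n) → Perm.insert i j π ⟨$⟩ʳ i ≡ j
insert-self i j π with i Fin.≟ i
... | yes _  = ≡.refl
... | no i≢i = contradiction ≡.refl i≢i

<pred⁻ : m < pred n → ℕ.suc m < n
<pred⁻ {n = ℕ.suc n} m<n = s≤s m<n

pred≤⁻ : pred n ≤ m → n ≤ ℕ.suc m
pred≤⁻ {n = ℕ.zero}  _   = z≤n
pred≤⁻ {n = ℕ.suc n} n≤m = s≤s n≤m

record Separation {m : ℕ} (P : Pred (Fin m) p) (r : ℕ) : Set p where
  field
    σ        : Permutation′ m
    σ-fixes  : ∀ i → toℕ i < r → σ ⟨$⟩ʳ i ≡ i
    k        : ℕ
    r≤k      : r ≤ k
    k≤m      : k ≤ m
    satisfy  : ∀ i → toℕ i < k → P (σ ⟨$⟩ʳ i)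
    violate  : ∀ i → k ≤ toℕ i → ¬ P (σ ⟨$⟩ʳ i)

-- Induction on `m`. If index 0 satisfies `P` it stays in front, otherwise it goes to the very end.
-- The second case arises only for `r = 0`, so the protected initial segment never moves.
separate : {P : Pred (Fin m) p} → Decidable P → ∀ r → r ≤ m →
  (∀ i → toℕ i < r → P i) → Separation P r
separate {m = ℕ.zero} P? r r≤0 initial = record
  { σ = Perm.id ; σ-fixes = λ () ; k = 0 ; r≤k = r≤0 ; k≤m = z≤n
  ; satisfy = λ () ; violate = λ () }
separate {m = ℕ.suc m} P? r r≤m initial with P? zero
separate {m = ℕ.suc m} {P = P} P? r r≤m initial | yes P0 = record
  { σ = Perm.lift₀ σ
  ; σ-fixes = λ where
      zero    _   → ≡.refl
      (suc i) i<r → ≡.cong suc (σ-fixes i (ℕ.suc[m]≤n⇒m≤pred[n] i<r))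
  ; k = ℕ.suc k ; r≤k = pred≤⁻ r≤k ; k≤m = s≤s k≤m
  ; satisfy = λ where
      zero    _         → P0
      (suc i) (s≤s i<k) → satisfy i i<k
  ; violate = λ where
      (suc i) (s≤s k≤i) → violate i k≤i }
  where
  -- `pred` also covers `r = 0`, where no index is protected.
  open Separation (separate (P? ∘ suc) (pred r) (ℕ.pred-mono-≤ r≤m)
    (λ i i<r → initial (suc i) (<pred⁻ i<r)))
separate P? (ℕ.suc r) r≤m initial | no ¬P0 = contradiction (initial zero z<s) ¬P0
separate {m = ℕ.suc m} {P = P} P? ℕ.zero r≤m initial | no ¬P0 = record
  { σ = σ′ ; σ-fixes = λ _ () ; k = k ; r≤k = z≤n ; k≤m = ℕ.m≤n⇒m≤1+n k≤m
  ; satisfy = satisfy′ ; violate = violate′ }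
  where
  open Separation (separate (P? ∘ suc) 0 z≤n λ _ ())
  σ′ : Permutation′ (ℕ.suc m)
  -- The last position receives the violating index 0; every other position follows `σ`, with its
  -- value raised by one.
  σ′ = Perm.insert (fromℕ m) zero σ
  σ′-inject₁ : ∀ i → σ′ ⟨$⟩ʳ inject₁ i ≡ suc (σ ⟨$⟩ʳ i)
  σ′-inject₁ i = ≡.trans (≡.cong (σ′ ⟨$⟩ʳ_) (≡.sym (punchIn-fromℕ i)))
    (Perm.insert-punchIn (fromℕ m) zero σ i)
  satisfy′ : ∀ i → toℕ i < k → P (σ′ ⟨$⟩ʳ i)
  satisfy′ i i<k with view i
  ... | ‵fromℕ = contradiction (subst (_< k) (Fin.toℕ-fromℕ m) i<k) (ℕ.≤⇒≯ k≤m)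
  ... | ‵inject₁ j = subst P (≡.sym (σ′-inject₁ j))
    (satisfy j (subst (_< k) (Fin.toℕ-inject₁ j) i<k))
  violate′ : ∀ i → k ≤ toℕ i → ¬ P (σ′ ⟨$⟩ʳ i)
  violate′ i k≤i with view i
  ... | ‵fromℕ = ¬P0 ∘ subst P (insert-self (fromℕ m) zero σ)
  ... | ‵inject₁ j = violate j (subst (k ≤_) (Fin.toℕ-inject₁ j) k≤i) ∘ subst P (σ′-inject₁ j)

-- Group identities and decidable subsets

module FiniteGroup {c ℓ : Level} (G : FiniteAbelianGroup c ℓ) where

  open Subsets G
  open AbelianGroup group using
    ( commutativeMonoid; refl; sym; trans; assoc; comm; identityˡ; identityʳ
    ; inverseʳ; ∙-cong; ∙-congˡ; ∙-congʳ; ⁻¹-cong)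
  open AbelianGroupProperties group using
    ( xyx⁻¹≈y; ⁻¹-anti-homo‿-; ⁻¹-∙-comm; ε⁻¹≈ε; ∙-cancelˡ
    ; //-rightDividesˡ; //-rightDividesʳ)
  open Inverse enumeration using (to; from; to-cong; strictlyInverseˡ; strictlyInverseʳ)
  open Summation commutativeMonoid using (sum; ∑-distrib-+; sum-replicate-zero)

  x-[y-z]≈z+[x-y] : ∀ x y z → x - (y - z) ≈ z + (x - y)
  x-[y-z]≈z+[x-y] x y z =
    trans (∙-congˡ (⁻¹-anti-homo‿- y z))
    (trans (sym (assoc x z (- y)))
    (trans (∙-congʳ (comm x z)) (assoc z x (- y))))

  x-[x-y]≈y : ∀ x y → x - (x - y) ≈ y
  x-[x-y]≈y x y = trans (x-[y-z]≈z+[x-y] x x y) (trans (∙-congˡ (inverseʳ x)) (identityʳ y))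

  x+[y-x]≈y : ∀ x y → x + (y - x) ≈ y
  x+[y-x]≈y x y = trans (comm x (y - x)) (//-rightDividesˡ x y)

  to-injective : ∀ {x y} → to x ≡ to y → x ≈ y
  to-injective {x} {y} eq =
    trans (sym (strictlyInverseʳ x))
    (trans (Inverse.from-cong enumeration eq) (strictlyInverseʳ y))

  from-injective : ∀ {i j} → from i ≡ from j → i ≡ j
  from-injective {i} {j} eq =
    ≡.trans (≡.sym (strictlyInverseˡ i)) (≡.trans (≡.cong to eq) (strictlyInverseˡ j))

  any? : {P : Pred Carrier p} → P Respects _≈_ → Decidable P → Dec (Satisfiable P)
  any? resp P? = map′
    (λ (i , Pi) → from i , Pi)
    (λ (x , Px) → to x , resp (sym (strictlyInverseʳ x)) Px)
    (Fin.any? (P? ∘ from))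

  comprehension : {P : Pred Carrier p} → Decidable P → Subset size
  comprehension P? = tabulate (λ i → does (P? (from i)))

  comprehension-≐ : {P : Pred Carrier p} → P Respects _≈_ → (P? : Decidable P) →
    ⟦ comprehension P? ⟧ ≐ P
  comprehension-≐ {P = P} resp P? = sound , complete
    where
    lookup-does : ∀ x → _
    lookup-does x = Vec.lookup∘tabulate (λ i → does (P? (from i))) (to x)
    sound : ⟦ comprehension P? ⟧ ⊆ P
    sound {x} x∈ with P? (from (to x)) | ≡.trans (≡.sym (lookup-does x)) (Vec.[]=⇒lookup x∈)
    ... | yes Px | _  = resp (strictlyInverseʳ x) Px
    ... | no _   | ()
    complete : P ⊆ ⟦ comprehension P? ⟧
    complete {x} Px = Vec.lookup⇒[]= (to x) _ (≡.trans (lookup-does x)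
      (dec-true (P? (from (to x))) (resp (sym (strictlyInverseʳ x)) Px)))

  translation-≤ : ∀ g A B → (∀ {x} → x ∈ ⟦ A ⟧ → (g + x) ∈ ⟦ B ⟧) → ∣ A ∣ ≤ ∣ B ∣
  translation-≤ g A B f = ∣∣-mono-injection (λ i → to (g + from i))
    (λ {i} {j} eq → ≡.trans (≡.sym (strictlyInverseˡ i)) (≡.trans
      (to-cong (∙-cancelˡ g (from i) (from j) (to-injective eq))) (strictlyInverseˡ j)))
    A B (λ {i} i∈A → f (subst (Sub._∈ A) (≡.sym (strictlyInverseˡ i)) i∈A))

  -- Closure under translations

  _ClosedUnder_ : Pred Carrier p → Pred Carrier q → Set _
  U ClosedUnder K = ∀ {x k} → x ∈ U → k ∈ K → (x + k) ∈ U

  closed-cancel : {U : Pred Carrier p} {K : Pred Carrier q} →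
    U Respects _≈_ → IsSubgroup K → U ClosedUnder K →
    ∀ {x k} → (x + k) ∈ U → k ∈ K → x ∈ U
  closed-cancel resp K-sub closed {x} {k} x+k∈U k∈K =
    resp (//-rightDividesʳ k x) (closed x+k∈U (IsSubgroup.neg-closed K-sub k k∈K))

  -- Asking for both implications makes closure under negation immediate.
  Stabilises : Pred Carrier p → Pred Carrier _
  Stabilises U g = ∀ x → (x ∈ U → (x + g) ∈ U) × ((x + g) ∈ U → x ∈ U)

  stabiliser-isSubgroup : {U : Pred Carrier p} → U Respects _≈_ → IsSubgroup (Stabilises U)
  stabiliser-isSubgroup resp = record
    { resp = λ g≈h stab x →
        resp (∙-congˡ g≈h) ∘ proj₁ (stab x) , proj₂ (stab x) ∘ resp (∙-congˡ (sym g≈h))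
    ; 0∈ = λ x → resp (sym (identityʳ x)) , resp (identityʳ x)
    ; +-closed = λ g h stab-g stab-h x →
        resp (assoc x g h) ∘ proj₁ (stab-h (x + g)) ∘ proj₁ (stab-g x) ,
        proj₂ (stab-g x) ∘ proj₂ (stab-h (x + g)) ∘ resp (sym (assoc x g h))
    ; neg-closed = λ g stab x →
        proj₂ (stab (x - g)) ∘ resp (sym (//-rightDividesˡ g x)) ,
        resp (//-rightDividesˡ g x) ∘ proj₁ (stab (x - g))
    }

  stabilises? : {U : Pred Carrier p} → U Respects _≈_ → Decidable U → Decidable (Stabilises U)
  stabilises? resp U? g = all?
    (λ x≈y (f , f⁻¹) →
      resp (∙-congʳ x≈y) ∘ f ∘ resp (sym x≈y) , resp x≈y ∘ f⁻¹ ∘ resp (∙-congʳ (sym x≈y)))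
    (λ x → (U? x →-dec U? (x + g)) ×-dec (U? (x + g) →-dec U? x))

  -- Internal difference groups

  differenceGroup-≐ : ∀ A → ⟦ differenceGroup A ⟧ ≐ InDifferenceGroup A
  differenceGroup-≐ A = comprehension-≐
    (λ x≈y x∈ K K-sub diff → ⟦⟧-resp K x≈y (x∈ K K-sub diff)) (inDifferenceGroup? A)

  differenceGroup-isSubgroup : ∀ A → IsSubgroup ⟦ differenceGroup A ⟧
  differenceGroup-isSubgroup A = record
    { resp = ⟦⟧-resp (differenceGroup A)
    ; 0∈ = introduce (λ K K-sub _ → IsSubgroup.0∈ K-sub)
    ; +-closed = λ x y x∈ y∈ → introduce λ K K-sub diff →
        IsSubgroup.+-closed K-sub x y (eliminate x∈ K K-sub diff) (eliminate y∈ K K-sub diff)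
    ; neg-closed = λ x x∈ → introduce λ K K-sub diff →
        IsSubgroup.neg-closed K-sub x (eliminate x∈ K K-sub diff)
    }
    where
    introduce : InDifferenceGroup A ⊆ ⟦ differenceGroup A ⟧
    introduce = proj₂ (differenceGroup-≐ A)
    eliminate : ⟦ differenceGroup A ⟧ ⊆ InDifferenceGroup A
    eliminate = proj₁ (differenceGroup-≐ A)

  difference∈ : ∀ A → ContainsDifferences A (differenceGroup A)
  difference∈ A x y x∈ y∈ = proj₂ (differenceGroup-≐ A) λ K _ diff → diff x y x∈ y∈

  -- The stabiliser of `U` is a subgroup containing the differences of `A`, hence contains the group
  -- they generate. That group is an intersection over coded subsets, so `U` is taken decidable in
  -- order to code its stabiliser.
  closed-differenceGroup : {U : Pred Carrier p} → U Respects _≈_ → Decidable U → ∀ A →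
    (∀ {x a b} → x ∈ U → a ∈ ⟦ A ⟧ → b ∈ ⟦ A ⟧ → (x + (a - b)) ∈ U) →
    U ClosedUnder ⟦ differenceGroup A ⟧
  closed-differenceGroup {U = U} resp U? A shift {x} x∈U h∈H =
    proj₁ (sound (proj₁ (differenceGroup-≐ A) h∈H stabiliser
      (record
        { resp = ⟦⟧-resp stabiliser
        ; 0∈ = complete 0∈
        ; +-closed = λ g h g∈ h∈ → complete (+-closed g h (sound g∈) (sound h∈))
        ; neg-closed = λ g g∈ → complete (neg-closed g (sound g∈)) })
      λ a b a∈ b∈ → complete (stabilises-difference a∈ b∈)) x) x∈U
    where
    open IsSubgroup (stabiliser-isSubgroup resp) renaming (resp to stabilises-resp)
    stabiliser : Subset size
    stabiliser = comprehension (stabilises? resp U?)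
    sound : ⟦ stabiliser ⟧ ⊆ Stabilises U
    sound = proj₁ (comprehension-≐ stabilises-resp (stabilises? resp U?))
    complete : Stabilises U ⊆ ⟦ stabiliser ⟧
    complete = proj₂ (comprehension-≐ stabilises-resp (stabilises? resp U?))
    stabilises-difference : ∀ {a b} → a ∈ ⟦ A ⟧ → b ∈ ⟦ A ⟧ → Stabilises U (a - b)
    stabilises-difference {a} {b} a∈ b∈ y =
      (λ y∈U → shift y∈U a∈ b∈) ,
      -- The shift by `b - a` undoes the one by `a - b`.
      λ y+∈U → resp
        (trans (∙-congˡ (sym (⁻¹-anti-homo‿- a b))) (//-rightDividesʳ (a - b) y))
        (shift y+∈U b∈ a∈)

  -- Sums of subgroups

  closed-sumOf : ∀ {r} {K : Fin r → Pred Carrier q} {U : Pred Carrier p} → U Respects _≈_ →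
    (∀ i → U ClosedUnder K i) → U ClosedUnder SumOf K
  closed-sumOf {U = U} resp closed {x} x∈U (h , h∈ , y≈) =
    resp (∙-congˡ (sym y≈)) (add-sum closed x∈U h h∈)
    where
    add-sum : ∀ {r} {K : Fin r → Pred Carrier _} → (∀ i → U ClosedUnder K i) →
      ∀ {x} → x ∈ U → (h : Fin r → Carrier) → (∀ i → h i ∈ K i) → (x + sum h) ∈ U
    add-sum {ℕ.zero}  closed {x} x∈U h h∈ = resp (sym (identityʳ x)) x∈U
    add-sum {ℕ.suc r} closed {x} x∈U h h∈ = resp (assoc x _ _)
      (add-sum (closed ∘ suc) (closed zero x∈U (h∈ zero)) (h ∘ suc) (h∈ ∘ suc))

  sumOf-isSubgroup : ∀ {r} {K : Fin r → Pred Carrier p} → (∀ i → IsSubgroup (K i)) →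
    IsSubgroup (SumOf K)
  sumOf-isSubgroup {r = r} K-sub = record
    { resp = λ x≈y (h , h∈ , x≈) → h , h∈ , trans (sym x≈y) x≈
    ; 0∈ = (λ _ → 0#) , (λ i → IsSubgroup.0∈ (K-sub i)) , sym (sum-replicate-zero r)
    ; +-closed = λ x y (g , g∈ , x≈) (h , h∈ , y≈) →
        (λ i → g i + h i) , (λ i → IsSubgroup.+-closed (K-sub i) _ _ (g∈ i) (h∈ i)) ,
        trans (∙-cong x≈ y≈) (sym (∑-distrib-+ g h))
    ; neg-closed = λ x (h , h∈ , x≈) →
        (λ i → - h i) , (λ i → IsSubgroup.neg-closed (K-sub i) _ (h∈ i)) ,
        trans (⁻¹-cong x≈) (sum-neg h)
    }
    where
    sum-neg : ∀ {r} (h : Fin r → Carrier) → - sum h ≈ sum (λ i → - h i)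
    sum-neg {ℕ.zero}  h = ε⁻¹≈ε
    sum-neg {ℕ.suc r} h = trans (sym (⁻¹-∙-comm _ _)) (∙-congˡ (sum-neg (h ∘ suc)))

  summand⊆sumOf : ∀ {r} {K : Fin r → Pred Carrier p} → (∀ i → IsSubgroup (K i)) →
    ∀ i → K i ⊆ SumOf K
  summand⊆sumOf {r = ℕ.suc r} K-sub zero {x} x∈ =
    (x ∷ᶠ λ _ → 0#) ,
    (λ where
      zero    → x∈
      (suc i) → IsSubgroup.0∈ (K-sub (suc i))) ,
    sym (trans (∙-congˡ (sum-replicate-zero r)) (identityʳ x))
  summand⊆sumOf {K = K} K-sub (suc i) {x} x∈ with summand⊆sumOf (K-sub ∘ suc) i x∈
  ... | h , h∈ , x≈ =
    (0# ∷ᶠ h) ,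
    (λ where
      zero    → IsSubgroup.0∈ (K-sub zero)
      (suc j) → h∈ j) ,
    trans x≈ (sym (identityˡ (sum h)))

  -- Search for the first summand `y` and decide recursively whether `x - y` is a sum of the others.
  sumOf? : ∀ {r} {K : Fin r → Pred Carrier p} → (∀ i → K i Respects _≈_) →
    (∀ i → Decidable (K i)) → Decidable (SumOf K)
  sumOf? {r = ℕ.zero} resp K? x = map′
    (λ x≈0 → (λ ()) , (λ ()) , x≈0) (λ (_ , _ , x≈0) → x≈0) (x ≈? 0#)
  sumOf? {r = ℕ.suc r} {K = K} resp K? x = map′
    (λ (y , y∈ , h , h∈ , x-y≈) →
      (y ∷ᶠ h) ,
      (λ where
        zero    → y∈
        (suc i) → h∈ i) ,
      trans (sym (x+[y-x]≈y y x)) (∙-congˡ x-y≈))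
    (λ (h , h∈ , x≈) → h zero , h∈ zero , h ∘ suc , h∈ ∘ suc ,
      trans (∙-congʳ x≈) (xyx⁻¹≈y (h zero) _))
    (any?
      (λ y≈z (y∈ , h , h∈ , x-y≈) →
        resp zero y≈z y∈ , h , h∈ , trans (∙-congˡ (⁻¹-cong (sym y≈z))) x-y≈)
      (λ y → K? zero y ×-dec sumOf? (resp ∘ suc) (K? ∘ suc) (x - y)))

  -- Disjoint sets and the counting of external pairs

  module DisjointSets {m : ℕ} (A : Fin m → Subset size)
    (disjoint : PairwiseDisjoint (λ i → ⟦ A i ⟧)) where

    Support : Pred Carrier _
    Support = ⋃ (Fin m) (λ i → ⟦ A i ⟧)

    Support-resp : Support Respects _≈_
    Support-resp x≈y (i , x∈) = i , ⟦⟧-resp (A i) x≈y x∈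

    Others : Fin m → Pred Carrier _
    Others i x = ∃ λ j → j ≢ i × x ∈ ⟦ A j ⟧

    Others-resp : ∀ i → Others i Respects _≈_
    Others-resp i x≈y (j , j≢i , x∈) = j , j≢i , ⟦⟧-resp (A j) x≈y x∈

    others? : ∀ i → Decidable (Others i)
    others? i x = Fin.any? (λ j → ¬? (j Fin.≟ i) ×-dec ⟦ A j ⟧? x)

    others⊆support : ∀ {i} → Others i ⊆ Support
    others⊆support (j , _ , x∈) = j , x∈

    ∉others : ∀ {i x} → x ∈ ⟦ A i ⟧ → x ∉ Others i
    ∉others x∈ (j , j≢i , x∈′) = disjoint j _ j≢i (x∈′ , x∈)

    module Translation (bimodal : IsBimodal A) (i : Fin m) (δ : Carrier) where

      pairs : List (Carrier × Carrier)
      pairs = filter (externalPair? A i δ) (cartesianProduct (elements A) (elements A))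

      -- Lists are duplicate-free up to `≡`, while the group works up to `≈`. Between canonical
      -- representatives the two agree.
      Enumerated : Pred Carrier _
      Enumerated x = x ≡ from (to x)

      elements-enumerated : ∀ {x} → x List.∈ elements A → Enumerated x
      elements-enumerated x∈ with i , _ , ≡.refl ← List.∈-map⁻ from x∈ =
        ≡.cong from (≡.sym (strictlyInverseˡ i))

      pairs-properties : All
        (λ (a , b) → ExternalPair A i δ (a , b) × Enumerated a × Enumerated b) pairs
      pairs-properties = All.tabulate λ {(a , b)} ab∈ →
        let ab∈product , external = List.∈-filter⁻ (externalPair? A i δ) ab∈
            a∈ , b∈ = List.∈-cartesianProduct⁻ (elements A) (elements A) ab∈product
        in external , elements-enumerated a∈ , elements-enumerated b∈

      second≈ : ∀ {a b} → a - b ≈ δ → b ≈ a - δ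
      second≈ {a} {b} eq = trans (sym (x-[x-y]≈y a b)) (∙-congˡ (⁻¹-cong eq))

      -- The second coordinate is the first minus `δ`, so `N A i δ` counts the elements of `A i`
      -- whose shift by `- δ` lies in `Others i`.
      pairs-distinct : AllPairs (_≢_ on (to ∘ proj₁)) pairs
      pairs-distinct = AllPairs-refine
        (λ ((_ , _ , ab≈δ) , a≡ , b≡) ((_ , _ , cd≈δ) , c≡ , d≡) ab≢cd a≡c →
          ab≢cd (≡.cong₂ _,_
            (≡.trans a≡ (≡.trans (≡.cong from a≡c) (≡.sym c≡)))
            (≡.trans b≡ (≡.trans
              (≡.cong from (to-cong (trans (second≈ ab≈δ)
                (trans (∙-congʳ (to-injective a≡c)) (sym (second≈ cd≈δ))))))
              (≡.sym d≡)))))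
        pairs-properties
        (Unique.filter⁺ (externalPair? A i δ)
          (Unique.cartesianProduct⁺ elements-unique elements-unique))
        where elements-unique = Unique.map⁺ from-injective (Unique.allFin⁺ size)

      N≢0 : ∀ {a} → a ∈ ⟦ A i ⟧ → (a - δ) ∈ Others i → N A i δ ≢ 0
      N≢0 {a} a∈ (j , j≢i , a-δ∈) = ℕ.m<n⇒n≢0 (List.∈-length
        (List.∈-filter⁺ (externalPair? A i δ)
          (List.∈-cartesianProduct⁺ (enumerates a) (enumerates (a - δ)))
          ( ⟦⟧-resp (A i) (sym (strictlyInverseʳ a)) a∈
          , (j , j≢i , ⟦⟧-resp (A j) (sym (strictlyInverseʳ (a - δ))) a-δ∈)
          , trans (∙-cong (strictlyInverseʳ a) (⁻¹-cong (strictlyInverseʳ (a - δ))))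
              (x-[x-y]≈y a δ))))
        where
        enumerates : ∀ x → from (to x) List.∈ elements A
        enumerates x = List.∈-map⁺ from (List.∈-allFin (to x))

      -- The counted pairs have distinct first coordinates in `A i`, none of them `a`.
      N<∣A∣ : ∀ {a} → a ∈ ⟦ A i ⟧ → (a - δ) ∉ Others i → N A i δ < ∣ A i ∣
      N<∣A∣ {a} a∈ a-δ∉ = ℕ.≤-<-trans
        (length≤∣∣ (A i Sub.- to a) pairs-distinct
          (All.map
            (λ ((c∈ , d∈ , cd≈δ) , _) → Sub.x∈p∧x≢y⇒x∈p-y c∈ λ c≡a →
              a-δ∉ (Others-resp i
                (trans (second≈ cd≈δ) (∙-congʳ (to-injective c≡a))) d∈))
            pairs-properties))
        (Sub.x∈p⇒∣p-x∣<∣p∣ a∈)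

      -- The witness `a` excludes the count 0, and a failure at `b` would exclude the count
      -- `∣ A i ∣`.
      all-or-none : δ ≉ 0# → ∀ {a b} → a ∈ ⟦ A i ⟧ → b ∈ ⟦ A i ⟧ →
        (a - δ) ∈ Others i → (b - δ) ∈ Others i
      all-or-none δ≉0 {a} {b} a∈ b∈ a-δ∈ with bimodal i δ δ≉0
      ... | inj₁ N≡0 = contradiction N≡0 (N≢0 a∈ a-δ∈)
      ... | inj₂ N≡∣A∣ = decidable-stable (others? i (b - δ))
        λ b-δ∉ → ℕ.<⇒≢ (N<∣A∣ b∈ b-δ∉) N≡∣A∣

    others-closed-differenceGroup : IsBimodal A →
      ∀ i → Others i ClosedUnder ⟦ differenceGroup (A i) ⟧
    others-closed-differenceGroup bimodal i =
      closed-differenceGroup (Others-resp i) (others? i) (A i) shift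
      where
      shift : ∀ {x a b} → x ∈ Others i → a ∈ ⟦ A i ⟧ → b ∈ ⟦ A i ⟧ → (x + (a - b)) ∈ Others i
      shift {x} {a} {b} x∈ a∈ b∈ = Others-resp i
        (x-[y-z]≈z+[x-y] a b x)
        -- The choice `δ = b - x` gives `b - δ ≈ x`, which is in `Others i`, and
        -- `a - δ ≈ x + (a - b)`. It is nonzero because `b` is not in `Others i`.
        (Translation.all-or-none bimodal i (b - x) b-x≉0 b∈ a∈
          (Others-resp i (sym (x-[x-y]≈y b x)) x∈))
        where
        b-x≉0 : b - x ≉ 0#
        b-x≉0 b-x≈0 = ∉others b∈ (Others-resp i
          (trans (sym (identityʳ x)) (trans (∙-congˡ (sym b-x≈0)) (x+[y-x]≈y x b))) x∈)

    -- H is abstract because differenceGroup unfolds to a search over all subsets.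
    module ClosedFamily (H : Fin m → Subset size) (H-isSubgroup : ∀ i → IsSubgroup ⟦ H i ⟧)
      (difference∈ : ∀ i → ContainsDifferences (A i) (H i))
      (others-closed : ∀ i → Others i ClosedUnder ⟦ H i ⟧) where

      -- Holes in the cosets containing the sets

      Hole : Fin m → Pred Carrier _
      Hole i x = ∃ λ a → a ∈ ⟦ A i ⟧ × x ∈ (a ⊕ ⟦ H i ⟧) ∖ ⟦ A i ⟧

      -- The base point is immaterial, since two points of `A i` differ by an element of `H i`.
      hole-coset : ∀ {i a x} → a ∈ ⟦ A i ⟧ → x ∈ Hole i → x ∈ a ⊕ ⟦ H i ⟧
      hole-coset {i} {a} {x} a∈ (b , b∈ , (h , h∈ , x≈) , _) =
        (b - a) + h ,
        IsSubgroup.+-closed (H-isSubgroup i) _ _ (difference∈ i b a b∈ a∈) h∈ ,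
        trans x≈ (trans (∙-congʳ (sym (x+[y-x]≈y a b))) (assoc a (b - a) h))

      -- If `x` were in another `A j`, closure of `Others i` under `H i` would carry it back to a
      -- point of `A i`.
      hole∩support : ∀ {i x} → x ∈ Hole i → x ∉ Support
      hole∩support {i} {x} (a , a∈ , (h , h∈ , x≈) , x∉) (j , x∈) with j Fin.≟ i
      ... | yes ≡.refl = x∉ x∈
      ... | no j≢i = ∉others a∈
        (closed-cancel (Others-resp i) (H-isSubgroup i) (others-closed i)
          (Others-resp i x≈ (j , j≢i , x∈)) h∈)

      Hole-resp : ∀ i → Hole i Respects _≈_
      Hole-resp i x≈y (a , a∈ , (h , h∈ , x≈) , x∉) =
        a , a∈ , (h , h∈ , trans (sym x≈y) x≈) , x∉ ∘ ⟦⟧-resp (A i) (sym x≈y)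

      in-coset : ∀ {i a x} → a ∈ ⟦ A i ⟧ → x ∈ a ⊕ ⟦ H i ⟧ → x ∈ ⟦ A i ⟧ ∪ Hole i
      in-coset {i} {a} {x} a∈ x∈ with ⟦ A i ⟧? x
      ... | yes x∈A = inj₁ x∈A
      ... | no x∉A  = inj₂ (a , a∈ , x∈ , x∉A)

      -- This union consists of `Others i` and the whole `H i`-coset around `A i`.
      support∪hole-closed : ∀ i → (Support ∪ Hole i) ClosedUnder ⟦ H i ⟧
      support∪hole-closed i {x} {h} (inj₁ (j , x∈)) h∈ with j Fin.≟ i
      ... | no j≢i = inj₁ (others⊆support (others-closed i (j , j≢i , x∈) h∈))
      ... | yes ≡.refl = Sum.map₁ (i ,_) (in-coset x∈ (h , h∈ , refl))
      support∪hole-closed i {x} {h} (inj₂ (a , a∈ , (k , k∈ , x≈) , _)) h∈ =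
        Sum.map₁ (i ,_) (in-coset a∈
          ( k + h
          , IsSubgroup.+-closed (H-isSubgroup i) k h k∈ h∈
          , trans (∙-congʳ x≈) (assoc a k h)))

      support∪hole-resp : ∀ i → (Support ∪ Hole i) Respects _≈_
      support∪hole-resp i x≈y = Sum.map (Support-resp x≈y) (Hole-resp i x≈y)

      -- If d = b + h were a point of Hole j outside Hole i, then d + H i would
      -- avoid the support, forcing b + H i ⊆ A j and so H i ⊆ H j; but then the
      -- H j-translates of the points of A i would cover Hole i.
      hole⊆hole : ∀ {i j} → i ≢ j → Satisfiable (Hole i) → Hole j ⊆ Hole i
      hole⊆hole {i} {j} i≢j (e , e∈@(a , a∈ , (k , k∈ , e≈) , _)) {d}
        d∈@(b , b∈ , (h , h∈ , d≈) , _) with ⟦ H i ⟧? (d - a)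
      ... | yes d-a∈ =
        a , a∈ , (d - a , d-a∈ , sym (x+[y-x]≈y a d)) , λ d∈A → hole∩support d∈ (i , d∈A)
      ... | no d-a∉ = contradiction (others⊆support e∈others) (hole∩support e∈)
        where
        outside : ∀ {l} → l ∈ ⟦ H i ⟧ → (d + l) ∉ Support
        outside l∈ d+l∈ with closed-cancel (support∪hole-resp i) (H-isSubgroup i)
          (support∪hole-closed i) (inj₁ d+l∈) l∈
        ... | inj₁ d∈support = hole∩support d∈ d∈support
        ... | inj₂ d∈hole with l , l∈ , d≈′ ← hole-coset a∈ d∈hole =
          d-a∉ (⟦⟧-resp (H i) (sym (trans (∙-congʳ d≈′) (xyx⁻¹≈y a l))) l∈)
        H⊆H : ⟦ H i ⟧ ⊆ ⟦ H j ⟧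
        H⊆H {l} l∈ with others-closed i (j , i≢j ∘ ≡.sym , b∈) l∈
        ... | n , _ , b+l∈ with n Fin.≟ j
        ...   | yes ≡.refl = ⟦⟧-resp (H j) (xyx⁻¹≈y b l) (difference∈ j _ _ b+l∈ b∈)
        -- If `b + l` were in `A n` with `n ≢ j`, adding `h` from `H j` would keep it in `Others j`;
        -- but the result is `d + l`, which is outside the support.
        ...   | no n≢j = contradiction
          (Support-resp
            (trans (assoc b l h) (trans (∙-congˡ (comm l h))
              (trans (sym (assoc b h l)) (∙-congʳ (sym d≈)))))
            (others⊆support (others-closed j (n , n≢j , b+l∈) h∈)))
          (outside l∈)
        e∈others : e ∈ Others j
        e∈others = Others-resp j (sym e≈) (others-closed j (i , i≢j , a∈) (H⊆H k∈))

      -- Without a hole, translation by `a` would embed `H i` into `A i`.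
      hole-satisfiable : ∀ {i} → Satisfiable ⟦ A i ⟧ → ∣ A i ∣ < ∣ H i ∣ → Satisfiable (Hole i)
      hole-satisfiable {i} (a , a∈) A<H with any?
        (λ x≈y (x∈ , a+x∉) → ⟦⟧-resp (H i) x≈y x∈ , a+x∉ ∘ ⟦⟧-resp (A i) (∙-congˡ (sym x≈y)))
        (λ x → ⟦ H i ⟧? x ×-dec ¬? (⟦ A i ⟧? (a + x)))
      ... | yes (h , h∈ , a+h∉) = a + h , a , a∈ , (h , h∈ , refl) , a+h∉
      ... | no ¬∃ = contradiction
        (translation-≤ a (H i) (A i) λ {x} x∈ →
          decidable-stable (⟦ A i ⟧? (a + x)) λ a+x∉ → ¬∃ (x , x∈ , a+x∉))
        (ℕ.<⇒≱ A<H)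

      -- If `a + h` were missing from `A i`, translation by `- a` would embed `A i` into `H i`
      -- without `h`, making `A i` smaller than `H i`.
      coset-of-H : ∀ {i a} → a ∈ ⟦ A i ⟧ → ¬ ∣ A i ∣ < ∣ H i ∣ → ⟦ A i ⟧ ≐ (a ⊕ ⟦ H i ⟧)
      coset-of-H {i} {a} a∈ A≮H =
        (λ {x} x∈ → x - a , difference∈ i x a x∈ a∈ , sym (x+[y-x]≈y a x)) ,
        λ {x} (h , h∈ , x≈) → decidable-stable (⟦ A i ⟧? x) λ x∉ → A≮H
          (ℕ.≤-<-trans
            (translation-≤ (- a) (A i) (H i Sub.- to h) λ {y} y∈ →
              Sub.x∈p∧x≢y⇒x∈p-y
                (⟦⟧-resp (H i) (comm y (- a)) (difference∈ i y a y∈ a∈))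
                (λ -a+y≡h → x∉ (⟦⟧-resp (A i)
                  (trans (sym (x+[y-x]≈y a y)) (trans
                    (∙-congˡ (trans (comm y (- a)) (to-injective -a+y≡h))) (sym x≈))) y∈)))
            (Sub.x∈p⇒∣p-x∣<∣p∣ h∈))

      -- Structure in canonical position

      module Canonical (nonempty : ∀ i → Satisfiable ⟦ A i ⟧)
        {r : ℕ} (r≤m : r ≤ m)
        (deficient : ∀ i → (∣ A i ∣ < ∣ H i ∣) ⇔ (toℕ i < r))
        {D : Pred Carrier p} (D-isSubgroup : IsSubgroup D)
        (i₁ : Fin m) (i₁<r : toℕ i₁ < r) (D≐hole₁ : D ≐ Hole i₁) where

        private module D = IsSubgroup D-isSubgroup

        hole-nonempty : ∀ {i} → toℕ i < r → Satisfiable (Hole i)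
        hole-nonempty {i} i<r = hole-satisfiable (nonempty i) (Equivalence.from (deficient i) i<r)

        D≐hole : ∀ {i} → toℕ i < r → D ≐ Hole i
        D≐hole {i} i<r with i Fin.≟ i₁
        ... | yes ≡.refl = D≐hole₁
        ... | no i≢i₁ =
          hole⊆hole i≢i₁ (hole-nonempty i<r) ∘ proj₁ D≐hole₁ ,
          proj₂ D≐hole₁ ∘ hole⊆hole (i≢i₁ ∘ ≡.sym) (hole-nonempty i₁<r)

        D∩support : ∀ {x} → x ∈ D → x ∉ Support
        D∩support x∈ = hole∩support (proj₁ D≐hole₁ x∈)

        -- The hole is `D`, which contains 0, so the coset of `H i` around `A i` is `H i` itself.
        A⊆H : ∀ {i} → toℕ i < r → ⟦ A i ⟧ ⊆ ⟦ H i ⟧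
        A⊆H {i} i<r {x} x∈ with h , h∈ , 0≈ ← hole-coset x∈ (proj₁ (D≐hole i<r) D.0∈) =
          ⟦⟧-resp (H i)
            (trans (sym (identityˡ (- h))) (trans (∙-congʳ 0≈) (//-rightDividesʳ h x)))
            (IsSubgroup.neg-closed (H-isSubgroup i) h h∈)

        D⊆H : ∀ {i} → toℕ i < r → D ⊆ ⟦ H i ⟧
        D⊆H {i} i<r x∈ with h , h∈ , x≈ ← hole-coset (proj₂ (nonempty i)) (proj₁ (D≐hole i<r) x∈) =
          ⟦⟧-resp (H i) (sym x≈)
            (IsSubgroup.+-closed (H-isSubgroup i) _ h (A⊆H i<r (proj₂ (nonempty i))) h∈)

        H⊆A∪D : ∀ {i} → toℕ i < r → ⟦ H i ⟧ ⊆ ⟦ A i ⟧ ∪ D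
        H⊆A∪D {i} i<r {x} x∈ with a , a∈ ← nonempty i =
          Sum.map₂ (proj₂ (D≐hole i<r)) (in-coset a∈
            ( x - a
            , IsSubgroup.+-closed (H-isSubgroup i) x (- a) x∈
                (IsSubgroup.neg-closed (H-isSubgroup i) a (A⊆H i<r a∈))
            , sym (x+[y-x]≈y a x)))

        K : Fin r → Pred Carrier _
        K i = ⟦ H (inject≤ i r≤m) ⟧

        K-isSubgroup : ∀ i → IsSubgroup (K i)
        K-isSubgroup i = H-isSubgroup (inject≤ i r≤m)

        inject<r : (i : Fin r) → toℕ (inject≤ i r≤m) < r
        inject<r i = subst (_< r) (≡.sym (Fin.toℕ-inject≤ i r≤m)) (Fin.toℕ<n i)

        star : IsStar K D
        star i j i≢j = intersection , λ x∈ → D⊆H (inject<r i) x∈ , D⊆H (inject<r j) x∈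
          where
          intersection : ∀ {x} → x ∈ K i × x ∈ K j → x ∈ D
          intersection (x∈i , x∈j) with H⊆A∪D (inject<r i) x∈i | H⊆A∪D (inject<r j) x∈j
          ... | inj₂ x∈D | _        = x∈D
          ... | inj₁ _   | inj₂ x∈D = x∈D
          -- Outside `D`, the point would lie in two distinct members of the disjoint family.
          ... | inj₁ x∈A | inj₁ x∈A′ = contradiction (x∈A , x∈A′)
            (disjoint _ _ (i≢j ∘ Fin.inject≤-injective r≤m r≤m i j))

        A≐H∖D : ∀ i → toℕ i < r → ⟦ A i ⟧ ≐ (⟦ H i ⟧ ∖ D)
        A≐H∖D i i<r = (λ x∈ → A⊆H i<r x∈ , λ x∈D → D∩support x∈D (i , x∈)) , from-H
          where
          from-H : (⟦ H i ⟧ ∖ D) ⊆ ⟦ A i ⟧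
          from-H (x∈ , x∉D) with H⊆A∪D i<r x∈
          ... | inj₁ x∈A = x∈A
          ... | inj₂ x∈D = contradiction x∈D x∉D

        full : ∀ {i a} → r ≤ toℕ i → a ∈ ⟦ A i ⟧ → ⟦ A i ⟧ ≐ (a ⊕ ⟦ H i ⟧)
        full {i} r≤i a∈ = coset-of-H a∈ (ℕ.≤⇒≯ r≤i ∘ Equivalence.to (deficient i))

        -- Here `A i` is a full coset of `H i`, so there is no hole to add.
        support-closed : ∀ {i} → r ≤ toℕ i → Support ClosedUnder ⟦ H i ⟧
        support-closed {i} r≤i {x} {h} (j , x∈) h∈ with j Fin.≟ i
        ... | yes ≡.refl = i , proj₂ (full r≤i x∈) (h , h∈ , refl)
        ... | no j≢i     = others⊆support (others-closed i (j , j≢i , x∈) h∈)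

        support∪D-resp : (Support ∪ D) Respects _≈_
        support∪D-resp x≈y = Sum.map (Support-resp x≈y) (D.resp x≈y)

        support∪D-closed : ∀ {i} → toℕ i < r → (Support ∪ D) ClosedUnder ⟦ H i ⟧
        support∪D-closed {i} i<r x∈ h∈ = Sum.map₂ (proj₂ (D≐hole i<r))
          (support∪hole-closed i (Sum.map₂ (proj₁ (D≐hole i<r)) x∈) h∈)

        H⊆D : ∀ {i} → r ≤ toℕ i → ⟦ H i ⟧ ⊆ D
        H⊆D {i} r≤i {h} h∈ with a , a∈ ← nonempty i₁
          -- First `a + h` is in the support; then `- a`, an element of `H i₁`, moves it to `h`
          -- within `Support ∪ D`.
          with support∪D-resp (xyx⁻¹≈y a h) (support∪D-closed i₁<r
            (inj₁ (support-closed r≤i (i₁ , a∈) h∈))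
            (IsSubgroup.neg-closed (H-isSubgroup i₁) a (A⊆H i₁<r a∈)))
        ... | inj₂ h∈D = h∈D
        ... | inj₁ h∈support = contradiction
          (Support-resp (inverseʳ h) (support-closed r≤i h∈support
            (IsSubgroup.neg-closed (H-isSubgroup i) h h∈)))
          (D∩support D.0∈)

        -- Cosets of the sum of the first r difference groups

        HΣ : Pred Carrier _
        HΣ = SumOf K

        private module HΣ = IsSubgroup (sumOf-isSubgroup K-isSubgroup)

        H⊆HΣ-initial : ∀ {i} → toℕ i < r → ⟦ H i ⟧ ⊆ HΣ
        H⊆HΣ-initial {i} i<r {x} x∈ = summand⊆sumOf K-isSubgroup (fromℕ< i<r)
          (subst (λ j → x ∈ ⟦ H j ⟧)
            (≡.sym (inject≤-fromℕ< i<r r≤m))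
            x∈)

        D⊆HΣ : D ⊆ HΣ
        D⊆HΣ = H⊆HΣ-initial i₁<r ∘ D⊆H i₁<r

        H⊆HΣ : ∀ i → ⟦ H i ⟧ ⊆ HΣ
        H⊆HΣ i with toℕ i ℕ.<? r
        ... | yes i<r = H⊆HΣ-initial i<r
        ... | no i≮r  = D⊆HΣ ∘ H⊆D (ℕ.≮⇒≥ i≮r)

        A⊆coset : ∀ {i a} → a ∈ ⟦ A i ⟧ → ⟦ A i ⟧ ⊆ a ⊕ HΣ
        A⊆coset {i} {a} a∈ {x} x∈ =
          x - a , H⊆HΣ i (difference∈ i x a x∈ a∈) , sym (x+[y-x]≈y a x)

        -- Each set lies in one coset of `HΣ`, so a single representative decides whether it lies
        -- inside `HΣ`; `Inside` tests just that.
        A⊆HΣ : ∀ {i a x} → a ∈ ⟦ A i ⟧ → a ∈ HΣ → x ∈ ⟦ A i ⟧ → x ∈ HΣ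
        A⊆HΣ a∈ a∈HΣ x∈ with h , h∈ , x≈ ← A⊆coset a∈ x∈ =
          HΣ.resp (sym x≈) (HΣ.+-closed _ h a∈HΣ h∈)

        support∪D-closed-HΣ : (Support ∪ D) ClosedUnder HΣ
        support∪D-closed-HΣ = closed-sumOf support∪D-resp (support∪D-closed ∘ inject<r)

        HΣ∖D⊆support : (HΣ ∖ D) ⊆ Support
        HΣ∖D⊆support {x} (x∈ , x∉D)
          -- The element `x` is reached by translating 0, a point of `D`, within `Support ∪ D`.
          with support∪D-resp (identityˡ x) (support∪D-closed-HΣ (inj₂ D.0∈) x∈)
        ... | inj₁ x∈support = x∈support
        ... | inj₂ x∈D       = contradiction x∈D x∉D

        -- Separating the sets inside `HΣ` from the others

        Inside : Pred (Fin m) _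
        Inside i = proj₁ (nonempty i) ∈ HΣ

        inside-initial : ∀ i → toℕ i < r → Inside i
        inside-initial i i<r = H⊆HΣ i (A⊆H i<r (proj₂ (nonempty i)))

        separation : Separation Inside r
        separation = separate
          (λ i → sumOf? (λ j → IsSubgroup.resp (K-isSubgroup j)) (λ j → ⟦ H (inject≤ j r≤m) ⟧?) _)
          r r≤m inside-initial

        open Separation separation public

        B : Fin m → Subset size
        B i = A (σ ⟨$⟩ʳ i)

        σ-position : ∀ {j x} → x ∈ ⟦ A j ⟧ → x ∈ ⟦ B (σ Perm.⟨$⟩ˡ j) ⟧
        σ-position {x = x} = subst (λ j → x ∈ ⟦ A j ⟧) (≡.sym (Perm.inverseʳ σ))

        B∩HΣ⇒<k : ∀ {i x} → x ∈ ⟦ B i ⟧ → x ∈ HΣ → toℕ i < k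
        B∩HΣ⇒<k {i} x∈ x∈HΣ = ℕ.≰⇒> λ k≤i →
          violate i k≤i (A⊆HΣ x∈ x∈HΣ (proj₂ (nonempty (σ ⟨$⟩ʳ i))))

        partition : IsPartitionOf (HΣ ∖ D) (λ (i : Fin k) → ⟦ B (inject≤ i k≤m) ⟧)
        partition =
          (λ i → nonempty (σ ⟨$⟩ʳ inject≤ i k≤m)) ,
          (λ i j i≢j → disjoint _ _
            (i≢j ∘ Fin.inject≤-injective k≤m k≤m i j ∘ Injection.injective (↔⇒↣ σ))) ,
          covered ,
          λ {x} (i , x∈) →
            A⊆HΣ (proj₂ (nonempty (σ ⟨$⟩ʳ inject≤ i k≤m)))
              (satisfy _ (subst (_< k) (≡.sym (Fin.toℕ-inject≤ i k≤m)) (Fin.toℕ<n i))) x∈ ,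
            λ x∈D → D∩support x∈D (_ , x∈)
          where
          covered : (HΣ ∖ D) ⊆ ⋃ (Fin k) (λ i → ⟦ B (inject≤ i k≤m) ⟧)
          covered {x} x∈@(x∈HΣ , _) with j , x∈A ← HΣ∖D⊆support x∈ =
            fromℕ< i<k ,
            subst (λ i → x ∈ ⟦ B i ⟧)
              (≡.sym (inject≤-fromℕ< i<k k≤m))
              (σ-position x∈A)
            where
            i<k : toℕ (σ Perm.⟨$⟩ˡ j) < k
            i<k = B∩HΣ⇒<k (σ-position x∈A) x∈HΣ

        Tail : Pred Carrier _
        Tail x = ∃ λ i → k ≤ toℕ i × x ∈ ⟦ B i ⟧

        tail-resp : Tail Respects _≈_
        tail-resp x≈y (i , k≤i , x∈) = i , k≤i , ⟦⟧-resp (B i) x≈y x∈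

        tail? : Decidable Tail
        tail? x = Fin.any? (λ i → (k ℕ.≤? toℕ i) ×-dec ⟦ B i ⟧? x)

        -- The translate `x + h` stays in `Support ∪ D`. If it were in `D` or in one of the first
        -- `k` sets, it would be in `HΣ`, and subtracting `h` would put `x` there too.
        tail-closed : Tail ClosedUnder HΣ
        tail-closed {x} {h} (i , k≤i , x∈) h∈ with support∪D-closed-HΣ (inj₁ (_ , x∈)) h∈
        ... | inj₂ x+h∈D = contradiction
          (B∩HΣ⇒<k x∈ (HΣ.resp (//-rightDividesʳ h x)
            (HΣ.+-closed _ _ (D⊆HΣ x+h∈D) (HΣ.neg-closed h h∈))))
          (ℕ.≤⇒≯ k≤i)
        ... | inj₁ (j , x+h∈A) = σ Perm.⟨$⟩ˡ j , ℕ.≮⇒≥ j≮k , σ-position x+h∈A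
          where
          j≮k : ¬ toℕ (σ Perm.⟨$⟩ˡ j) < k
          j≮k j<k = ℕ.≤⇒≯ k≤i (B∩HΣ⇒<k x∈ (HΣ.resp (//-rightDividesʳ h x)
            (HΣ.+-closed _ _ x+h∈HΣ (HΣ.neg-closed h h∈))))
            where
            x+h∈HΣ : (x + h) ∈ HΣ
            x+h∈HΣ = A⊆HΣ (proj₂ (nonempty _)) (satisfy _ j<k) (σ-position x+h∈A)

        tail-unionOfCosets : IsUnionOfCosetsOf HΣ Tail
        tail-unionOfCosets = comprehension tail? ,
          -- Every point of `Tail` serves as its own coset representative.
          (λ {x} x∈ → x , proj₂ T≐Tail x∈ , 0# , HΣ.0∈ , sym (identityʳ x)) ,
          λ (t , t∈ , h , h∈ , x≈) → tail-resp (sym x≈) (tail-closed (proj₁ T≐Tail t∈) h∈)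
          where
          T≐Tail : ⟦ comprehension tail? ⟧ ≐ Tail
          T≐Tail = comprehension-≐ tail-resp tail?

        -- Sets with original index below `r` lie inside `HΣ`, so every tail set is a full coset of
        -- its difference group.
        tail-r≤ : ∀ {i} → k ≤ toℕ i → r ≤ toℕ (σ ⟨$⟩ʳ i)
        tail-r≤ {i} k≤i = ℕ.≮⇒≥ (violate i k≤i ∘ inside-initial (σ ⟨$⟩ʳ i))

theorem3p10 :
  {c ℓ : Level} (G : FiniteAbelianGroup c ℓ) → let open Subsets G in
  (m : ℕ) (A : Fin m → Subset size) →
  (∀ i → Satisfiable ⟦ A i ⟧) →
  PairwiseDisjoint (λ i → ⟦ A i ⟧) →
  IsBimodal A →
  (r : ℕ) (2≤r : 2 ≤ r) (r≤m : r ≤ m) →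
  let H : Fin m → Subset size
      H i = differenceGroup (A i)
  in
  (∀ i → (∣ A i ∣ < ∣ H i ∣) ⇔ (toℕ i < r)) →
  (i₁ : Fin m) → toℕ i₁ ≡ 0 →
  (a₁ : Carrier) → a₁ ∈ ⟦ A i₁ ⟧ →
  let D  = (a₁ ⊕ ⟦ H i₁ ⟧) ∖ ⟦ A i₁ ⟧
      HΣ = SumOf (λ (i : Fin r) → ⟦ H (inject≤ i r≤m) ⟧)
  in
  IsSubgroup D →
  -- (1)
  ( IsStar (λ (i : Fin r) → ⟦ H (inject≤ i r≤m) ⟧) D
  × (∀ i → toℕ i < r → ⟦ A i ⟧ ≐ (⟦ H i ⟧ ∖ D)) )
  -- (2)
  × (∀ i → r ≤ toℕ i →
       ∃ λ K → IsSubgroup ⟦ K ⟧ × ⟦ K ⟧ ⊆ D × IsCosetOf ⟦ K ⟧ ⟦ A i ⟧)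
  -- (3)
  × (HΣ ∖ D) ⊆ ⋃ (Fin m) (λ i → ⟦ A i ⟧)
  × ∃ λ (σ : Permutation′ m) → (∀ i → toℕ i < r → σ ⟨$⟩ʳ i ≡ i) ×
    let B : Fin m → Subset size
        B i = A (σ ⟨$⟩ʳ i)
    in
    ∃ λ k → r ≤ k × ∃ λ (k≤m : k ≤ m) →
      IsPartitionOf (HΣ ∖ D) (λ (i : Fin k) → ⟦ B (inject≤ i k≤m) ⟧)
      -- (4)
      × (k < m →
           IsUnionOfCosetsOf HΣ (λ x → ∃ λ i → k ≤ toℕ i × x ∈ ⟦ B i ⟧)
           × (∀ i → k ≤ toℕ i →
                (∃ λ K → IsSubgroup ⟦ K ⟧ × IsCosetOf ⟦ K ⟧ ⟦ B i ⟧)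
                × (∃ λ g → ⟦ B i ⟧ ⊆ (g ⊕ HΣ))))
theorem3p10 G m A nonempty disjoint bimodal r 2≤r r≤m deficient i₁ i₁≡0 a₁ a₁∈ D-isSubgroup =
  (star , A≐H∖D) ,
  (λ i r≤i → differenceGroup (A i) , isSubgroup i , H⊆D r≤i , _ , full r≤i (proj₂ (nonempty i))) ,
  HΣ∖D⊆support ,
  σ , σ-fixes , k , r≤k , k≤m , partition ,
  λ _ → tail-unionOfCosets ,
    λ i k≤i → let a , a∈ = nonempty (σ ⟨$⟩ʳ i) in
      (differenceGroup (A (σ ⟨$⟩ʳ i)) , isSubgroup (σ ⟨$⟩ʳ i) , a , full (tail-r≤ k≤i) a∈) ,
      a , A⊆coset a∈
  where
  open Subsets G using (differenceGroup)
  open FiniteGroup G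
  isSubgroup = λ i → differenceGroup-isSubgroup (A i)
  open DisjointSets A disjoint
  open ClosedFamily (λ i → differenceGroup (A i)) isSubgroup
    (λ i → difference∈ (A i)) (others-closed-differenceGroup bimodal)
  open Canonical nonempty r≤m deficient D-isSubgroup i₁
    (subst (_< r) (≡.sym i₁≡0) (ℕ.<⇒≤ 2≤r))
    -- `D` is formed at the base point `a₁`, whereas `Hole i₁` admits any base point; `hole-coset`
    -- changes it back to `a₁`.
    ( (λ x∈ → a₁ , a₁∈ , x∈)
    , λ x∈ → hole-coset a₁∈ x∈ , proj₂ (proj₂ (proj₂ x∈)) )
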